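{- Let $q\in\mathbb{N}$ and let $A$ be a finite set of positive integers all coprime to $q$. For each $1\le k\le q$ let $n_k$ be the number of elements of $A$ congruent to $k$ modulo $q$. If $|A|>72\sqrt{q}$ and $$\sum_{k=1}^{q}n_k^2<\frac{|A|^3}{7776q},$$ then $\Sigma^*(A)$ covers all residue classes modulo $q$.
   Context: $\Sigma^*(A)$ is the set of sums $\sum_{a\in A'}a$ over nonempty subsets $A'\subseteq A$. -}

module Defs where

open import Data.Nat using (ℕ; zero; suc; _+_; _*_; _%_; NonZero)
open import Data.Nat.Properties using (_≟_)
open import Data.List using (List; []; _∷_; length; filter; map; upTo)
open import Data.Nat.ListAction using (sum)
open import Data.List.Relation.Binary.Sublist.Propositional using (_⊆_)
open import Data.Product using (Σ; _×_)
open import Relation.Binary.PropositionalEquality using (_≡_; _≢_)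

countRes : (q : ℕ) .{{_ : NonZero q}} → List ℕ → ℕ → ℕ
countRes q A k = length (filter (λ a → (a % q) ≟ (k % q)) A)

sumSqCounts : (q : ℕ) .{{_ : NonZero q}} → List ℕ → ℕ
sumSqCounts q A = sum (map (λ i → countRes q A (suc i) * countRes q A (suc i)) (upTo q))

-- s ∈ Σ*(A): s is the sum of a nonempty sub-collection of A
-- (A is a duplicate-free list representing a finite set; sub-collections are sublists)
InSubsetSums : List ℕ → ℕ → Set
InSubsetSums A s = Σ (List ℕ) (λ B → (B ⊆ A) × (B ≢ []) × (sum B ≡ s))

{-# OPTIONS --safe #-}

-- For a set S of residues let gain S a be the number of x ∉ S with x + a ∈ S; it
-- is subadditive in a, and adjoining S − a to S adds exactly gain S a elements. If
-- gain S c ≤ μ for all c in a set C of units, then gain S ≤ kμ on a set which by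
-- Chowla's theorem has more than k|C| elements (or is everything), whereas the
-- overlaps |S ∩ (S − x)| sum to only |S|². Hence for |S| ≤ q/2 some c ∈ C has gain
-- at least about min(|S|, |C|)/8.
--
-- As long as n/6 elements of A (n = |A|) are unused, Cauchy–Schwarz and the bound on
-- Σ n_k² show that they occupy at least 216 q/n residue classes. Greedily choosing
-- elements of large gain from one half of A therefore makes the set of subset sums
-- exceed q/2, and two sets of more than q/2 residues represent everything. (When
-- n > 4q, the gain of at least 1 provided by any unit is enough.)
module Submission where

open import Defs
import Algebra.Properties.Semiring.Sum
open import Data.Bool using (true; false; if_then_else_)
open import Data.Fin using (toℕ)
open import Data.List using (List; []; _∷_; _++_; length; map; upTo; applyUpTo; filter; take; drop)
open import Data.List.Membership.Propositional using (find; lose) renaming (_∈_ to _∈ˡ_)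
open import Data.List.Properties using (map-upTo; take++drop≡id; length-take; length-drop)
open import Data.List.Relation.Binary.Sublist.Propositional
  using ([]; _∷_; _∷ʳ_; ⊆-refl; ⊆-trans; minimum; lookup) renaming (_⊆_ to _⊑_)
open import Data.List.Relation.Binary.Sublist.Propositional.Properties
  using (filter⁺; length-mono-≤; ++⁺; take-⊆; drop-⊆)
open import Data.List.Relation.Unary.All as All using (All)
open import Data.List.Relation.Unary.Any using (here; there; any?)
open import Data.List.Relation.Unary.Unique.Propositional using (Unique)
open import Data.Nat
open import Data.Nat.DivMod
open import Data.Nat.GCD using (gcd; gcd-GCD; module Bézout)
open import Data.Nat.ListAction using (sum)
open import Data.Nat.ListAction.Properties using (sum-++)
open import Data.Nat.Properties
open import Data.Nat.Tactic.RingSolver using (solve-∀)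
open import Data.Product using (Σ; ∃; _×_; _,_; proj₂; swap)
open import Data.Sum as Sum using (_⊎_; inj₁; inj₂)
open import Data.Unit using (⊤; tt)
open import Function using (_∘_)
open import Relation.Binary.PropositionalEquality hiding (resp)
open import Relation.Nullary
open import Relation.Nullary.Decidable using (decidable-stable)

-- Finite sums over an initial segment of ℕ.

private module ℕ-Sum = Algebra.Properties.Semiring.Sum +-*-semiring

∑ : ℕ → (ℕ → ℕ) → ℕ
∑ n f = ℕ-Sum.sum {n} (f ∘ toℕ)

∑-cong : ∀ n {f g : ℕ → ℕ} → (∀ i → f i ≡ g i) → ∑ n f ≡ ∑ n g
∑-cong n {f} {g} f≗g = ℕ-Sum.sum-cong-≗ {n} {f ∘ toℕ} {g ∘ toℕ} (f≗g ∘ toℕ)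

∑-+ : ∀ n (f g : ℕ → ℕ) → ∑ n (λ i → f i + g i) ≡ ∑ n f + ∑ n g
∑-+ n f g = ℕ-Sum.∑-distrib-+ {n} (f ∘ toℕ) (g ∘ toℕ)

∑-* : ∀ n c (f : ℕ → ℕ) → ∑ n (λ i → c * f i) ≡ c * ∑ n f
∑-* n c f = sym (ℕ-Sum.*-distribˡ-sum {n} c (f ∘ toℕ))

∑-*ʳ : ∀ n c (f : ℕ → ℕ) → ∑ n (λ i → f i * c) ≡ ∑ n f * c
∑-*ʳ n c f = sym (ℕ-Sum.*-distribʳ-sum {n} c (f ∘ toℕ))

∑-comm : ∀ m n (f : ℕ → ℕ → ℕ) → ∑ m (λ i → ∑ n (f i)) ≡ ∑ n (λ j → ∑ m (λ i → f i j))
∑-comm m n f = ℕ-Sum.∑-comm {m} {n} (λ i j → f (toℕ i) (toℕ j))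

∑-const : ∀ n c → ∑ n (λ _ → c) ≡ n * c
∑-const zero    c = refl
∑-const (suc n) c = cong (c +_) (∑-const n c)

∑-mono : ∀ n {f g : ℕ → ℕ} → (∀ i → f i ≤ g i) → ∑ n f ≤ ∑ n g
∑-mono zero    f≤g = z≤n
∑-mono (suc n) f≤g = +-mono-≤ (f≤g 0) (∑-mono n (f≤g ∘ suc))

term≤∑ : ∀ {n i} (f : ℕ → ℕ) → i < n → f i ≤ ∑ n f
term≤∑ {suc n} {zero}  f _         = m≤m+n (f 0) _
term≤∑ {suc n} {suc i} f (s≤s i<n) = ≤-trans (term≤∑ (f ∘ suc) i<n) (m≤n+m _ (f 0))

∑-pigeonhole : ∀ n (f g : ℕ → ℕ) → ∑ n f < ∑ n g → ∃ λ i → i < n × f i < g i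
∑-pigeonhole (suc n) f g ∑f<∑g with f 0 <? g 0
... | yes f<g = 0 , z<s , f<g
... | no  f≮g =
  let i , i<n , f<g = ∑-pigeonhole n (f ∘ suc) (g ∘ suc) (≰⇒> λ ∑g≤∑f →
        <⇒≱ ∑f<∑g (+-mono-≤ (≮⇒≥ f≮g) ∑g≤∑f))
  in suc i , s<s i<n , f<g

-- Moving the window by one trades `f 0` for `f n`. Both ends are kept to avoid subtraction; they
-- cancel when `f` has period `n`, which gives `∑-shift`.
∑-suc : ∀ n (f : ℕ → ℕ) → ∑ n (f ∘ suc) + f 0 ≡ ∑ n f + f n
∑-suc zero    f = refl
∑-suc (suc n) f = begin
  f 1 + ∑ n (f ∘ suc ∘ suc) + f 0    ≡⟨ cong (_+ f 0) (+-comm (f 1) _) ⟩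
  ∑ n (f ∘ suc ∘ suc) + f 1 + f 0    ≡⟨ cong (_+ f 0) (∑-suc n (f ∘ suc)) ⟩
  ∑ n (f ∘ suc) + f (suc n) + f 0    ≡⟨ +-comm _ (f 0) ⟩
  f 0 + (∑ n (f ∘ suc) + f (suc n))  ≡⟨ +-assoc (f 0) _ _ ⟨
  f 0 + ∑ n (f ∘ suc) + f (suc n)    ∎
  where open ≡-Reasoning

-- Cauchy–Schwarz for f = d f, with d the indicator of the support of f.
∑-Cauchy-Schwarz : ∀ n (f d : ℕ → ℕ) → (∀ i → f i ≤ d i * f i) →
                   ∑ n f * ∑ n f ≤ ∑ n d * ∑ n (λ i → f i * f i)
∑-Cauchy-Schwarz zero    f d f≤df = z≤n
∑-Cauchy-Schwarz (suc n) f d f≤df = go (f 0) (d 0) (∑ n (f ∘ suc)) (∑ n (d ∘ suc)) _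
  (f≤df 0) (∑-Cauchy-Schwarz n (f ∘ suc) (d ∘ suc) (f≤df ∘ suc))
  where
  open ≤-Reasoning
  square-cancel-≤ : ∀ {x y} → x * x ≤ y * y → x ≤ y
  square-cancel-≤ xx≤yy = ≮⇒≥ λ y<x → <⇒≱ (*-mono-< y<x y<x) xx≤yy

  4xy≤[x+y]² : ∀ x y → 4 * (x * y) ≤ (x + y) * (x + y)
  4xy≤[x+y]² x y with ≤-total x y
  ... | inj₁ x≤y with k , refl ← m≤n⇒∃[o]m+o≡n x≤y =
    ≤-trans (m≤m+n _ (k * k)) (≤-reflexive (lem x k))
    where lem : ∀ x k → 4 * (x * (x + k)) + k * k ≡ (x + (x + k)) * (x + (x + k))
          lem = solve-∀
  ... | inj₂ y≤x with k , refl ← m≤n⇒∃[o]m+o≡n y≤x =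
    ≤-trans (m≤m+n _ (k * k)) (≤-reflexive (lem y k))
    where lem : ∀ x k → 4 * ((x + k) * x) + k * k ≡ (x + k + x) * (x + k + x)
          lem = solve-∀

  go : ∀ a c s d e → a ≤ c * a → s * s ≤ d * e → (a + s) * (a + s) ≤ (c + d) * (a * a + e)
  go zero c s d e _ ss≤de = ≤-trans ss≤de (*-monoˡ-≤ e (m≤n+m d c))
  go a@(suc _) zero s d e () ss≤de
  go a (suc c) s d e _ ss≤de = begin
    (a + s) * (a + s)                                    ≡⟨ l₁ a s ⟩
    a * a + s * s + 2 * (a * s)                          ≤⟨ +-mono-≤ (+-monoʳ-≤ (a * a) ss≤de) cross ⟩
    a * a + d * e + (d * (a * a) + e)                    ≤⟨ m≤m+n _ (c * (a * a + e)) ⟩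
    a * a + d * e + (d * (a * a) + e) + c * (a * a + e)  ≡⟨ l₂ a c d e ⟩
    (suc c + d) * (a * a + e)                            ∎
    where
    l₁ : ∀ a s → (a + s) * (a + s) ≡ a * a + s * s + 2 * (a * s)
    l₁ = solve-∀
    l₂ : ∀ a c d e → a * a + d * e + (d * (a * a) + e) + c * (a * a + e) ≡ (suc c + d) * (a * a + e)
    l₂ = solve-∀
    l₃ : ∀ a s → 2 * (a * s) * (2 * (a * s)) ≡ 4 * (a * a) * (s * s)
    l₃ = solve-∀
    l₄ : ∀ a d e → 4 * (a * a) * (d * e) ≡ 4 * (d * (a * a) * e)
    l₄ = solve-∀
    -- AM-GM for `d * (a * a)` and `e`, whose product is at least `a * a * (s * s)` by `ss≤de`.
    cross : 2 * (a * s) ≤ d * (a * a) + e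
    cross = square-cancel-≤ (begin
      2 * (a * s) * (2 * (a * s))            ≡⟨ l₃ a s ⟩
      4 * (a * a) * (s * s)                  ≤⟨ *-monoʳ-≤ (4 * (a * a)) ss≤de ⟩
      4 * (a * a) * (d * e)                  ≡⟨ l₄ a d e ⟩
      4 * (d * (a * a) * e)                  ≤⟨ 4xy≤[x+y]² (d * (a * a)) e ⟩
      (d * (a * a) + e) * (d * (a * a) + e)  ∎)

-- Indicators of decidable propositions.

⟦_⟧ : ∀ {a} {P : Set a} → Dec P → ℕ
⟦ p? ⟧ = if does p? then 1 else 0

module _ {P Q : Set} where
  ⟦⟧-mono : (P → Q) → (p? : Dec P) (q? : Dec Q) → ⟦ p? ⟧ ≤ ⟦ q? ⟧
  ⟦⟧-mono f (no _)  _       = z≤n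
  ⟦⟧-mono f (yes _) (yes _) = ≤-refl
  ⟦⟧-mono f (yes p) (no ¬q) = contradiction (f p) ¬q

  ⟦⟧-∪-∩ : (p? : Dec P) (q? : Dec Q) → ⟦ p? ⊎-dec q? ⟧ + ⟦ p? ×-dec q? ⟧ ≡ ⟦ p? ⟧ + ⟦ q? ⟧
  ⟦⟧-∪-∩ (no _)  (no _)  = refl
  ⟦⟧-∪-∩ (no _)  (yes _) = refl
  ⟦⟧-∪-∩ (yes _) (no _)  = refl
  ⟦⟧-∪-∩ (yes _) (yes _) = refl

  ⟦⟧-∖-∩ : (p? : Dec P) (q? : Dec Q) → ⟦ p? ×-dec ¬? q? ⟧ + ⟦ p? ×-dec q? ⟧ ≡ ⟦ p? ⟧
  ⟦⟧-∖-∩ (no _)  (no _)  = refl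
  ⟦⟧-∖-∩ (no _)  (yes _) = refl
  ⟦⟧-∖-∩ (yes _) (no _)  = refl
  ⟦⟧-∖-∩ (yes _) (yes _) = refl

  ⟦⟧-∪-∖ : (p? : Dec P) (q? : Dec Q) → ⟦ p? ⊎-dec q? ⟧ ≡ ⟦ p? ⟧ + ⟦ q? ×-dec ¬? p? ⟧
  ⟦⟧-∪-∖ (no _)  (no _)  = refl
  ⟦⟧-∪-∖ (no _)  (yes _) = refl
  ⟦⟧-∪-∖ (yes _) (no _)  = refl
  ⟦⟧-∪-∖ (yes _) (yes _) = refl

  ⟦⟧-× : (p? : Dec P) (q? : Dec Q) → ⟦ p? ×-dec q? ⟧ ≡ ⟦ q? ⟧ * ⟦ p? ⟧
  ⟦⟧-× (no _)  (no _)  = refl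
  ⟦⟧-× (no _)  (yes _) = refl
  ⟦⟧-× (yes _) (no _)  = refl
  ⟦⟧-× (yes _) (yes _) = refl

  ⟦⟧-< : (p? : Dec P) (q? : Dec Q) → ⟦ p? ⟧ < ⟦ q? ⟧ → Q × ¬ P
  ⟦⟧-< (no ¬p) (yes q) _ = q , ¬p
  ⟦⟧-< (yes _) (yes _) (s≤s ())

⟦⟧-yes : ∀ {P : Set} (p? : Dec P) → P → ⟦ p? ⟧ ≡ 1
⟦⟧-yes (yes _) _ = refl
⟦⟧-yes (no ¬p) p = contradiction p ¬p

-- Sublist sums and rounded quotients.

sum-applyUpTo : ∀ (f : ℕ → ℕ) n → sum (applyUpTo f n) ≡ ∑ n f
sum-applyUpTo f zero    = refl
sum-applyUpTo f (suc n) = cong (f 0 +_) (sum-applyUpTo (f ∘ suc) n)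

-- `a` need not stand at the head of `L`, so a sublist of `R` may regain it in the middle; of the
-- result only the sum matters.
remove-∈ : ∀ {a L} → a ∈ˡ L → ∃ λ R → suc (length R) ≡ length L × R ⊑ L ×
           (∀ {B} → B ⊑ R → ∃ λ B′ → B′ ⊑ L × sum B′ ≡ a + sum B)
remove-∈ {L = a ∷ L} (here refl) = L , refl , a ∷ʳ ⊆-refl , λ {B} B⊑L → a ∷ B , refl ∷ B⊑L , refl
remove-∈ {a} {b ∷ L} (there a∈L) with R , len , R⊑L , add ← remove-∈ a∈L =
  b ∷ R , cong suc len , refl ∷ R⊑L , add′
  where
  l : ∀ b a s → b + (a + s) ≡ a + (b + s)
  l = solve-∀
  add′ : ∀ {B} → B ⊑ b ∷ R → ∃ λ B′ → B′ ⊑ b ∷ L × sum B′ ≡ a + sum B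
  add′ (b ∷ʳ B⊑R) with B′ , B′⊑L , eq ← add B⊑R = B′ , b ∷ʳ B′⊑L , eq
  add′ {b ∷ B} (refl ∷ B⊑R) with B′ , B′⊑L , eq ← add B⊑R =
    b ∷ B′ , refl ∷ B′⊑L , trans (cong (b +_) eq) (l b a (sum B))

complement : ∀ {B L} → B ⊑ L → ∃ λ B′ → B′ ⊑ L × sum B′ + sum B ≡ sum L
complement [] = [] , [] , refl
complement {B} (b ∷ʳ B⊑L) with B′ , B′⊑L , eq ← complement B⊑L =
  b ∷ B′ , refl ∷ B′⊑L , trans (+-assoc b (sum B′) (sum B)) (cong (b +_) eq)
complement {b ∷ B} (refl ∷ B⊑L) with B′ , B′⊑L , eq ← complement B⊑L =
  B′ , b ∷ʳ B′⊑L , trans (l b (sum B′) (sum B)) (cong (b +_) eq)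
  where
  l : ∀ b s t → s + (b + t) ≡ b + (s + t)
  l = solve-∀

-- With the next bound, `suc (n / d)` can stand in for the real quotient, which it exceeds by at
-- most one.
n<[1+n/d]*d : ∀ n d .{{_ : NonZero d}} → n < suc (n / d) * d
n<[1+n/d]*d n d = begin-strict
  n                  ≡⟨ m≡m%n+[m/n]*n n d ⟩
  n % d + n / d * d  <⟨ +-monoˡ-< (n / d * d) (m%n<n n d) ⟩
  suc (n / d) * d    ∎
  where open ≤-Reasoning

[1+n/d]*d≤n+d : ∀ n d .{{_ : NonZero d}} → suc (n / d) * d ≤ n + d
[1+n/d]*d≤n+d n d = begin
  d + n / d * d  ≤⟨ +-monoʳ-≤ d (m/n*n≤m n d) ⟩
  d + n          ≡⟨ +-comm d n ⟩
  n + d          ∎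
  where open ≤-Reasoning

-- Residue sets modulo q and their cardinalities.

module Cyclic (q : ℕ) .{{_ : NonZero q}} where

  infix 4 _≈_
  _≈_ : ℕ → ℕ → Set
  x ≈ y = x % q ≡ y % q

  +-cong-≈ : ∀ {w x y z} → w ≈ x → y ≈ z → w + y ≈ x + z
  +-cong-≈ {w} {x} {y} {z} w≈x y≈z = begin
    (w + y) % q          ≡⟨ %-distribˡ-+ w y q ⟩
    (w % q + y % q) % q  ≡⟨ cong₂ (λ a b → (a + b) % q) w≈x y≈z ⟩
    (x % q + z % q) % q  ≡⟨ %-distribˡ-+ x z q ⟨
    (x + z) % q          ∎
    where open ≡-Reasoning

  -- The additive inverse modulo q without subtraction: `a + a * (q - 1)` is a multiple of q.
  neg : ℕ → ℕ
  neg a = a * pred q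

  +-neg : ∀ a → a + neg a ≡ a * q
  +-neg a = trans (sym (*-suc a (pred q))) (cong (a *_) (suc-pred q))

  neg-cancel : ∀ a x → neg a + (a + x) ≈ x
  neg-cancel a x = trans (cong (_% q) eq) ([m+kn]%n≡m%n x a q)
    where
    eq : neg a + (a + x) ≡ x + a * q
    eq = begin
      neg a + (a + x)  ≡⟨ +-assoc (neg a) a x ⟨
      neg a + a + x    ≡⟨ cong (_+ x) (+-comm (neg a) a) ⟩
      a + neg a + x    ≡⟨ cong (_+ x) (+-neg a) ⟩
      a * q + x        ≡⟨ +-comm _ x ⟩
      x + a * q        ∎
      where open ≡-Reasoning

  ∑-shift : ∀ (f : ℕ → ℕ) → (∀ {x y} → x ≈ y → f x ≡ f y) → ∀ a → ∑ q (λ x → f (a + x)) ≡ ∑ q f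
  ∑-shift f f-cong zero    = refl
  ∑-shift f f-cong (suc a) = +-cancelʳ-≡ (f (a + 0)) _ _ (begin
    ∑ q (λ x → f (suc (a + x))) + f (a + 0)
      ≡⟨ cong (_+ f (a + 0)) (∑-cong q λ x → cong f (sym (+-suc a x))) ⟩
    ∑ q (λ x → f (a + suc x)) + f (a + 0)    ≡⟨ ∑-suc q (f ∘ (a +_)) ⟩
    ∑ q (λ x → f (a + x)) + f (a + q)        ≡⟨ cong₂ _+_ (∑-shift f f-cong a) (f-cong a+q≈a+0) ⟩
    ∑ q f + f (a + 0)                        ∎)
    where
    open ≡-Reasoning
    a+q≈a+0 : a + q ≈ a + 0
    a+q≈a+0 = trans ([m+n]%n≡m%n a q) (cong (_% q) (sym (+-identityʳ a)))

  -- Periodic predicates on ℕ instead of subsets of `Fin q`, so that translation is plain addition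
  -- with no reduction modulo q.
  record ResidueSet : Set₁ where
    field
      Mem  : ℕ → Set
      mem? : ∀ x → Dec (Mem x)
      resp : ∀ {x y} → x ≈ y → Mem x → Mem y
  open ResidueSet

  infix 4 _∈_ _∉_ _⊆_
  _∈_ _∉_ : ℕ → ResidueSet → Set
  x ∈ S = Mem S x
  x ∉ S = ¬ x ∈ S

  _⊆_ : ResidueSet → ResidueSet → Set
  S ⊆ T = ∀ {x} → x ∈ S → x ∈ T

  infixr 6 _∪_
  infixr 7 _∩_ _∖_
  _∪_ _∩_ _∖_ : ResidueSet → ResidueSet → ResidueSet
  (S ∪ T) .Mem  x = x ∈ S ⊎ x ∈ T
  (S ∪ T) .mem? x = mem? S x ⊎-dec mem? T x
  (S ∪ T) .resp e (inj₁ x∈S) = inj₁ (resp S e x∈S)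
  (S ∪ T) .resp e (inj₂ x∈T) = inj₂ (resp T e x∈T)
  (S ∩ T) .Mem  x = x ∈ S × x ∈ T
  (S ∩ T) .mem? x = mem? S x ×-dec mem? T x
  (S ∩ T) .resp e (x∈S , x∈T) = resp S e x∈S , resp T e x∈T
  (S ∖ T) .Mem  x = x ∈ S × x ∉ T
  (S ∖ T) .mem? x = mem? S x ×-dec ¬? (mem? T x)
  (S ∖ T) .resp e (x∈S , x∉T) = resp S e x∈S , x∉T ∘ resp T (sym e)

  -- The translate S − a.
  shift : ℕ → ResidueSet → ResidueSet
  shift a S .Mem  x = a + x ∈ S
  shift a S .mem? x = mem? S (a + x)
  shift a S .resp {x} {y} e = resp S (+-cong-≈ {a} {a} {x} {y} refl e)

  𝟙 : ResidueSet → ℕ → ℕ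
  𝟙 S x = ⟦ mem? S x ⟧

  card : ResidueSet → ℕ
  card S = ∑ q (𝟙 S)

  card-mono : ∀ S T → S ⊆ T → card S ≤ card T
  card-mono S T S⊆T = ∑-mono q λ x → ⟦⟧-mono S⊆T (mem? S x) (mem? T x)

  card-shift : ∀ a S → card (shift a S) ≡ card S
  card-shift a S = ∑-shift (𝟙 S) (λ {x} {y} e →
    ≤-antisym (⟦⟧-mono (resp S e) (mem? S x) (mem? S y))
              (⟦⟧-mono (resp S (sym e)) (mem? S y) (mem? S x))) a

  card-∪+card-∩ : ∀ S T → card (S ∪ T) + card (S ∩ T) ≡ card S + card T
  card-∪+card-∩ S T = begin
    card (S ∪ T) + card (S ∩ T)            ≡⟨ ∑-+ q (𝟙 (S ∪ T)) (𝟙 (S ∩ T)) ⟨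
    ∑ q (λ x → 𝟙 (S ∪ T) x + 𝟙 (S ∩ T) x)  ≡⟨ ∑-cong q (λ x → ⟦⟧-∪-∩ (mem? S x) (mem? T x)) ⟩
    ∑ q (λ x → 𝟙 S x + 𝟙 T x)              ≡⟨ ∑-+ q (𝟙 S) (𝟙 T) ⟩
    card S + card T                        ∎
    where open ≡-Reasoning

  card-∖+card-∩ : ∀ S T → card (S ∖ T) + card (S ∩ T) ≡ card S
  card-∖+card-∩ S T = trans (sym (∑-+ q (𝟙 (S ∖ T)) (𝟙 (S ∩ T))))
    (∑-cong q λ x → ⟦⟧-∖-∩ (mem? S x) (mem? T x))

  card-∪ : ∀ S T → card (S ∪ T) ≡ card S + card (T ∖ S)
  card-∪ S T = trans (∑-cong q λ x → ⟦⟧-∪-∖ (mem? S x) (mem? T x)) (∑-+ q (𝟙 S) (𝟙 (T ∖ S)))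

  card-∪≤ : ∀ S T → card (S ∪ T) ≤ card S + card T
  card-∪≤ S T = ≤-trans (m≤m+n _ _) (≤-reflexive (card-∪+card-∩ S T))

  card-full : ∀ S → (∀ x → x ∈ S) → card S ≡ q
  card-full S full = trans (∑-cong q λ x → ⟦⟧-yes (mem? S x) (full x))
    (trans (∑-const q 1) (*-identityʳ q))

  ∈⇒0<card : ∀ S {x} → x ∈ S → 0 < card S
  ∈⇒0<card S {x} x∈S = ≤-trans
    (≤-reflexive (sym (⟦⟧-yes (mem? S (x % q)) (resp S (sym (m%n%n≡m%n x q)) x∈S))))
    (term≤∑ (𝟙 S) (m%n<n x q))

  card<card⇒∃ : ∀ S T → card S < card T → ∃ λ x → x ∈ T × x ∉ S
  card<card⇒∃ S T S<T with x , _ , lt ← ∑-pigeonhole q (𝟙 S) (𝟙 T) S<T =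
    x , ⟦⟧-< (mem? S x) (mem? T x) lt

  universe : ResidueSet
  universe .Mem  _   = ⊤
  universe .mem? _   = yes tt
  universe .resp _ _ = tt

  card≤q : ∀ S → card S ≤ q
  card≤q S = ≤-trans (card-mono S universe _) (≤-reflexive (card-full universe _))

  card<q⇒∃∉ : ∀ S → card S < q → ∃ λ x → x ∉ S
  card<q⇒∃∉ S S<q =
    let x , _ , x∉S = card<card⇒∃ S universe (<-≤-trans S<q (≤-reflexive (sym (card-full universe _))))
    in x , x∉S

  -- Gains and overlaps of a set with its translates.

  boundary : ResidueSet → ℕ → ResidueSet
  boundary S a = shift a S ∖ S

  gain : ResidueSet → ℕ → ℕ
  gain S a = card (boundary S a)

  gain-cong : ∀ S {a b} → a ≈ b → gain S a ≤ gain S b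
  gain-cong S {a} {b} a≈b = card-mono (boundary S a) (boundary S b)
    λ {x} → λ (a+x∈S , x∉S) → resp S (+-cong-≈ {a} {b} {x} {x} a≈b refl) a+x∈S , x∉S

  -- Go from x to a + b + x through a + x. If a + x is in S, x is already counted for a; otherwise a
  -- + x is counted for b.
  gain-+ : ∀ S a b → gain S (a + b) ≤ gain S a + gain S b
  gain-+ S a b = begin
    gain S (a + b)
      ≤⟨ card-mono (boundary S (a + b)) (boundary S a ∪ shift a (boundary S b)) split ⟩
    card (boundary S a ∪ shift a (boundary S b))  ≤⟨ card-∪≤ (boundary S a) (shift a (boundary S b)) ⟩
    gain S a + card (shift a (boundary S b))      ≡⟨ cong (gain S a +_) (card-shift a (boundary S b)) ⟩
    gain S a + gain S b                           ∎
    where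
    open ≤-Reasoning
    l : ∀ a b x → a + b + x ≡ b + (a + x)
    l = solve-∀
    split : boundary S (a + b) ⊆ boundary S a ∪ shift a (boundary S b)
    split {x} (a+b+x∈S , x∉S) with mem? S (a + x)
    ... | yes a+x∈S = inj₁ (a+x∈S , x∉S)
    ... | no  a+x∉S = inj₂ (subst (_∈ S) (l a b x) a+b+x∈S , a+x∉S)

  ⊆⇒card-∖≡0 : ∀ S T → S ⊆ T → card (S ∖ T) ≡ 0
  ⊆⇒card-∖≡0 S T S⊆T = n≤0⇒n≡0 (+-cancelʳ-≤ (card (S ∩ T)) _ 0 (begin
    card (S ∖ T) + card (S ∩ T)  ≡⟨ card-∖+card-∩ S T ⟩
    card S                       ≤⟨ card-mono S (S ∩ T) (λ x∈S → x∈S , S⊆T x∈S) ⟩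
    card (S ∩ T)                 ∎))
    where open ≤-Reasoning

  gain-≈0 : ∀ S {a} → a ≈ 0 → gain S a ≡ 0
  gain-≈0 S {a} a≈0 = ⊆⇒card-∖≡0 (shift a S) S
    λ {x} → resp S (+-cong-≈ {a} {0} {x} {x} a≈0 refl)

  card-∪-shift : ∀ S a → card (S ∪ shift a S) ≡ card S + gain S a
  card-∪-shift S a = card-∪ S (shift a S)

  meet : ResidueSet → ℕ → ℕ
  meet S a = card (shift a S ∩ S)

  gain+meet : ∀ S a → gain S a + meet S a ≡ card S
  gain+meet S a = trans (card-∖+card-∩ (shift a S) S) (card-shift a S)

  -- Double counting of the pairs (y, a + y) in S × S: each y in S occurs with `card S` values of a.
  ∑-meet : ∀ S → ∑ q (meet S) ≡ card S * card S
  ∑-meet S = begin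
    ∑ q (λ a → ∑ q (λ y → 𝟙 (shift a S ∩ S) y))  ≡⟨ ∑-comm q q (λ a y → 𝟙 (shift a S ∩ S) y) ⟩
    ∑ q (λ y → ∑ q (λ a → 𝟙 (shift a S ∩ S) y))  ≡⟨ ∑-cong q inner ⟩
    ∑ q (λ y → 𝟙 S y * card S)                   ≡⟨ ∑-*ʳ q (card S) (𝟙 S) ⟩
    card S * card S                              ∎
    where
    open ≡-Reasoning
    inner : ∀ y → ∑ q (λ a → 𝟙 (shift a S ∩ S) y) ≡ 𝟙 S y * card S
    inner y = begin
      ∑ q (λ a → 𝟙 (shift a S ∩ S) y)  ≡⟨ ∑-cong q (λ a → ⟦⟧-× (mem? S (a + y)) (mem? S y)) ⟩
      ∑ q (λ a → 𝟙 S y * 𝟙 S (a + y))  ≡⟨ ∑-cong q (λ a → cong (λ z → 𝟙 S y * 𝟙 S z) (+-comm a y)) ⟩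
      ∑ q (λ a → 𝟙 S y * 𝟙 S (y + a))  ≡⟨ ∑-* q (𝟙 S y) (λ a → 𝟙 S (y + a)) ⟩
      𝟙 S y * card (shift y S)         ≡⟨ cong (𝟙 S y *_) (card-shift y S) ⟩
      𝟙 S y * card S                   ∎

  -- Each x in X has overlap at least |S| - m, and all overlaps together amount to |S|².
  gain≤⇒card*card≤ : ∀ S X m → (∀ {x} → x ∈ X → gain S x ≤ m) →
                 card X * card S ≤ card S * card S + card X * m
  gain≤⇒card*card≤ S X m gain≤m = begin
    card X * card S                       ≡⟨ ∑-*ʳ q (card S) (𝟙 X) ⟨
    ∑ q (λ x → 𝟙 X x * card S)            ≤⟨ ∑-mono q (λ x → pointwise x (mem? X x)) ⟩
    ∑ q (λ x → meet S x + 𝟙 X x * m)      ≡⟨ ∑-+ q (meet S) (λ x → 𝟙 X x * m) ⟩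
    ∑ q (meet S) + ∑ q (λ x → 𝟙 X x * m)  ≡⟨ cong₂ _+_ (∑-meet S) (∑-*ʳ q m (𝟙 X)) ⟩
    card S * card S + card X * m          ∎
    where
    open ≤-Reasoning
    pointwise : ∀ x → (x∈? : Dec (x ∈ X)) → ⟦ x∈? ⟧ * card S ≤ meet S x + ⟦ x∈? ⟧ * m
    pointwise x (no _)    = z≤n
    pointwise x (yes x∈X) = begin
      1 * card S           ≡⟨ *-identityˡ (card S) ⟩
      card S               ≡⟨ gain+meet S x ⟨
      gain S x + meet S x  ≤⟨ +-monoˡ-≤ _ (gain≤m x∈X) ⟩
      m + meet S x         ≡⟨ +-comm m _ ⟩
      meet S x + m         ≡⟨ cong (meet S x +_) (*-identityˡ m) ⟨
      meet S x + 1 * m     ∎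

  -- The previous bound reads |X| (|S| - m) ≤ |S|²; with |X| ≥ 2|S| this forces |S| - m ≤ |S|/2.
  card≤2gain : ∀ S X m → 2 * card S ≤ card X → (∀ {x} → x ∈ X → gain S x ≤ m) → card S ≤ 2 * m
  card≤2gain S X m 2s≤X gain≤m = ≮⇒≥ λ 2m<s →
    arith (card S) (card X) 2s≤X (gain≤⇒card*card≤ S X m gain≤m) 2m<s
    where
    l : ∀ t m e → t * (suc (2 * m) + e) ≡ t * (suc m + e) + t * m
    l = solve-∀
    l₂ : ∀ m e → suc (suc (2 * m) + e) + e ≡ 2 * (suc m + e)
    l₂ = solve-∀
    arith : ∀ s t → 2 * s ≤ t → t * s ≤ s * s + t * m → ¬ 2 * m < s
    -- Writing s = 2m + 1 + e turns s - m into `suc m + e`, whose double is s + 1 + e and hence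
    -- exceeds s.
    arith s t 2s≤t ts≤ 2m<s with e , refl ← m≤n⇒∃[o]m+o≡n 2m<s =
      <⇒≱ (≤-trans (m≤m+n (suc s) e) (≤-reflexive (l₂ m e)))
        (*-cancelˡ-≤ s (begin
          s * (2 * (suc m + e))  ≡⟨ *-assoc s 2 (suc m + e) ⟨
          s * 2 * (suc m + e)    ≡⟨ cong (_* (suc m + e)) (*-comm s 2) ⟩
          2 * s * (suc m + e)    ≤⟨ *-monoˡ-≤ (suc m + e) 2s≤t ⟩
          t * (suc m + e)        ≤⟨ +-cancelʳ-≤ (t * m) _ _ (≤-trans (≤-reflexive (sym (l t m e))) ts≤) ⟩
          s * s                  ∎))
      where open ≤-Reasoning

  -- Generators of the cyclic group of residues.

  Generator : ℕ → Set₁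
  Generator b = ∀ S → (∀ {x} → x ∈ S → b + x ∈ S) → ∀ {x₀} → x₀ ∈ S → ∀ x → x ∈ S

  Generator-resp : ∀ {a b} → a ≈ b → Generator a → Generator b
  Generator-resp {a} {b} a≈b gen S closed =
    gen S λ {x} x∈S → resp S (+-cong-≈ {b} {a} {x} {x} (sym a≈b) refl) (closed x∈S)

  -- By Bézout some multiple of b is 1 or -1 modulo q. In the first case climb from x₀ to x in x -
  -- x₀ unit steps, in the second descend in x₀ - x steps.
  coprime⇒Generator : ∀ {b} → gcd b q ≡ 1 → Generator b
  coprime⇒Generator {b} b⊥q S closed {x₀} x₀∈S x =
    go (subst (λ d → Bézout.Identity d b q) b⊥q (Bézout.identity (gcd-GCD b q)))
    where
    closed* : ∀ k {y} → y ∈ S → k * b + y ∈ S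
    closed* zero    y∈S = y∈S
    closed* (suc k) {y} y∈S = subst (_∈ S) (sym (+-assoc b (k * b) y)) (closed (closed* k y∈S))

    a+neg : ∀ a y → y + neg a + a ≈ y
    a+neg a y = trans (cong (_% q) (l y (neg a) a)) (neg-cancel a y)
      where
      l : ∀ y n a → y + n + a ≡ n + (a + y)
      l = solve-∀

    go : Bézout.Identity 1 b q → x ∈ S
    go (Bézout.+- k m eq) = resp S (a+neg x₀ x) (ascend (x + neg x₀) x₀∈S)
      where
      l : ∀ y t → suc t + y ≡ suc y + t
      l = solve-∀
      k*b+y≈suc-y : ∀ y → k * b + y ≈ suc y
      k*b+y≈suc-y y = trans
        (cong (_% q) (trans (cong (_+ y) (sym eq)) (l y (m * q))))
        ([m+kn]%n≡m%n (suc y) m q)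
      ascend : ∀ d {y} → y ∈ S → d + y ∈ S
      ascend zero    y∈S = y∈S
      ascend (suc d) {y} y∈S = resp S (k*b+y≈suc-y (d + y)) (closed* k (ascend d y∈S))
    go (Bézout.-+ k m eq) = descend (x₀ + neg x) (resp S (sym (a+neg x x₀)) x₀∈S)
      where
      k*b+suc-y≈y : ∀ y → k * b + suc y ≈ y
      k*b+suc-y≈y y = trans
        (cong (_% q) (trans (+-suc (k * b) y) (trans (cong (_+ y) eq) (+-comm (m * q) y))))
        ([m+kn]%n≡m%n y m q)
      descend : ∀ d {y} → d + y ∈ S → y ∈ S
      descend zero    y∈S = y∈S
      descend (suc d) {y} y∈S = descend d (resp S (k*b+suc-y≈y (d + y)) (closed* k y∈S))

  -- With zero gain the complement of S would be closed under adding b; containing y, it would be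
  -- everything, x included.
  gain-positive : ∀ S {b x y} → Generator b → x ∈ S → y ∉ S → 0 < gain S b
  gain-positive S {b} {x} {y} gen x∈S y∉S = ≰⇒> λ g≤0 →
    gen ∁ (λ {z} z∉S b+z∈S → <⇒≱ (∈⇒0<card (boundary S b) (b+z∈S , z∉S)) g≤0) y∉S x x∈S
    where
    ∁ : ResidueSet
    ∁ .Mem  z = z ∉ S
    ∁ .mem? z = ¬? (mem? S z)
    ∁ .resp e z∉S = z∉S ∘ resp S (sym e)

  -- Chowla's theorem.

  multiples : ResidueSet
  multiples .Mem  x = x ≈ 0
  multiples .mem? x = x % q ≟ 0 % q
  multiples .resp e x≈0 = trans (sym e) x≈0

  0<card⇒∃ : ∀ S → 0 < card S → ∃ λ x → x ∈ S
  0<card⇒∃ S 0<S =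
    let x , x∈S , _ = card<card⇒∃ (S ∖ S) S
          (≤-<-trans (≤-reflexive (⊆⇒card-∖≡0 S S λ x∈S → x∈S)) 0<S)
    in x , x∈S

  nonempty? : ∀ S → Dec (∃ λ x → x ∈ S)
  nonempty? S with 0 <? card S
  ... | yes 0<S = yes (0<card⇒∃ S 0<S)
  ... | no  0≮S = no λ (_ , x∈S) → 0≮S (∈⇒0<card S x∈S)

  -- Chowla's theorem, for a superset Y of A + B, by Davenport's transform;
  -- card multiples plays the role of 1.
  chowla : ∀ n A B Y → card B < n → (∀ {a b} → a ∈ A → b ∈ B → b + a ∈ Y) →
           0 ∈ B → (∀ {b} → b ∈ B → ¬ b ≈ 0 → Generator b) → ∀ {a} → a ∈ A →
           q ≤ card Y ⊎ card A + card B ≤ card Y + card multiples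
  chowla (suc n) A B Y B<n A+B⊆Y 0∈B gens {a} a∈A with card multiples <? card B
  ... | no  ≮B = inj₂ (+-mono-≤ (card-mono A Y (λ a∈A → A+B⊆Y a∈A 0∈B)) (≮⇒≥ ≮B))
  ... | yes <B with b , b∈B , b≉0 ← card<card⇒∃ multiples B <B | nonempty? (A ∖ shift b A)
  -- A is closed under adding the nonzero b, hence is everything.
  ...   | no  closed = inj₁ (≤-reflexive (sym (card-full Y λ x → A+B⊆Y (full x) 0∈B)))
    where
    full : ∀ x → x ∈ A
    full = gens b∈B b≉0 A
      (λ {x} x∈A → decidable-stable (mem? A (b + x)) λ b+x∉A → closed (x , x∈A , b+x∉A)) a∈A
  ...   | yes (e , e∈A , b+e∉A) = Sum.map₂ (≤-trans A+B≤A′+B′)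
          (chowla n A′ B′ Y (≤-trans B′<B (s≤s⁻¹ B<n)) A′+B′⊆Y
            (subst (_∈ A) (sym (+-identityʳ e)) e∈A , 0∈B) (gens ∘ proj₂) (inj₁ a∈A))
    where
    A′ B′ : ResidueSet
    -- The transform adjoins B + e to A and cuts B down to A - e. Since e is in A, 0 survives in B′;
    -- since b + e is not in A, b is lost, so B shrinks.
    A′ = A ∪ shift (neg e) B
    B′ = shift e A ∩ B

    A′+B′⊆Y : ∀ {x y} → x ∈ A′ → y ∈ B′ → y + x ∈ Y
    A′+B′⊆Y (inj₁ x∈A) (_ , y∈B) = A+B⊆Y x∈A y∈B
    A′+B′⊆Y {x} {y} (inj₂ x-e∈B) (e+y∈A , _) =
      resp Y (trans (cong (_% q) (l (neg e) x e y)) (neg-cancel e (y + x))) (A+B⊆Y e+y∈A x-e∈B)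
      where
      l : ∀ n x e y → n + x + (e + y) ≡ n + (e + (y + x))
      l = solve-∀

    B′<B : card B′ < card B
    B′<B = begin-strict
      card B′                                      ≡⟨⟩
      0 + card B′                                  ≤⟨ +-monoʳ-≤ 0 (card-mono B′ (B ∩ shift e A) swap) ⟩
      0 + card (B ∩ shift e A)
        <⟨ +-monoˡ-< _ (∈⇒0<card (B ∖ shift e A) (b∈B , b+e∉A ∘ subst (_∈ A) (+-comm e b))) ⟩
      card (B ∖ shift e A) + card (B ∩ shift e A)  ≡⟨ card-∖+card-∩ B (shift e A) ⟩
      card B                                       ∎
      where open ≤-Reasoning

    -- After translation by -e: A - e and B meet in B′, and their union lies in A′ - e.
    A+B≤A′+B′ : card A + card B ≤ card A′ + card B′
    A+B≤A′+B′ = begin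
      card A + card B                 ≡⟨ cong (_+ card B) (card-shift e A) ⟨
      card (shift e A) + card B       ≡⟨ card-∪+card-∩ (shift e A) B ⟨
      card (shift e A ∪ B) + card B′
        ≤⟨ +-monoˡ-≤ (card B′) (card-mono (shift e A ∪ B) (shift e A′) (λ {x} → Sum.map₂ (resp B (sym (neg-cancel e x))))) ⟩
      card (shift e A′) + card B′     ≡⟨ cong (_+ card B′) (card-shift e A′) ⟩
      card A′ + card B′               ∎
      where open ≤-Reasoning

  -- Growth of the sets of small gain.

  gain≤ : ResidueSet → ℕ → ResidueSet
  gain≤ S m .Mem  x = gain S x ≤ m
  gain≤ S m .mem? x = gain S x ≤? m
  gain≤ S m .resp e = ≤-trans (gain-cong S (sym e))

  module _ (S C : ResidueSet) {x y} (x∈S : x ∈ S) (y∉S : y ∉ S)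
           (gens : ∀ {c} → c ∈ C → Generator c)
           (μ : ℕ) (gain≤μ : ∀ {c} → c ∈ C → gain S c ≤ μ) where

    -- By subadditivity, adding C ∪ {0} to the level set of k μ stays in that of (k + 1) μ, so
    -- Chowla contributes |C| per step. The strict inequality comes from 0 in the first level set.
    card-gain≤ : ∀ k → q ≤ card (gain≤ S (k * μ)) ⊎ k * card C < card (gain≤ S (k * μ))
    card-gain≤ zero    = inj₂ (∈⇒0<card (gain≤ S 0) (≤-reflexive (gain-≈0 S {0} refl)))
    card-gain≤ (suc k) with card-gain≤ k
    ... | inj₁ q≤ = inj₁ (≤-trans q≤
          (card-mono (gain≤ S (k * μ)) (gain≤ S (suc k * μ)) (m≤n⇒m≤o+n μ)))
    ... | inj₂ k*C< = Sum.map₂ bound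
          (chowla _ X (C ∪ multiples) X′ ≤-refl X+C⊆X′ (inj₂ refl)
            (λ { (inj₁ c∈C) _ → gens c∈C ; (inj₂ c≈0) c≉0 → contradiction c≈0 c≉0 })
            {0} (≤-trans (≤-reflexive (gain-≈0 S {0} refl)) z≤n))
      where
      X X′ : ResidueSet
      X  = gain≤ S (k * μ)
      X′ = gain≤ S (suc k * μ)

      X+C⊆X′ : ∀ {a b} → a ∈ X → b ∈ C ∪ multiples → b + a ∈ X′
      X+C⊆X′ {a} {b} a∈X b∈ = ≤-trans (gain-+ S b a) (+-mono-≤ (gain≤μ₀ b∈) a∈X)
        where
        gain≤μ₀ : ∀ {b} → b ∈ C ∪ multiples → gain S b ≤ μ
        gain≤μ₀ (inj₁ b∈C) = gain≤μ b∈C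
        gain≤μ₀ {b} (inj₂ b≈0) = ≤-trans (≤-reflexive (gain-≈0 S {b} b≈0)) z≤n

      -- Members of C have positive gain and 0 has none, so adjoining 0 to C enlarges it by exactly
      -- `card multiples`.
      disjoint : multiples ⊆ multiples ∖ C
      disjoint {z} z≈0 = z≈0 , λ z∈C →
        <⇒≢ (gain-positive S (gens z∈C) x∈S y∉S) (sym (gain-≈0 S {z} z≈0))

      bound : card X + card (C ∪ multiples) ≤ card X′ + card multiples → suc k * card C < card X′
      bound le = +-cancelʳ-≤ (card multiples) _ _ (begin
        suc (suc k * card C) + card multiples         ≡⟨ l (card C) (k * card C) (card multiples) ⟩
        suc (k * card C) + (card C + card multiples)
          ≤⟨ +-mono-≤ k*C< (+-monoʳ-≤ (card C) (card-mono multiples (multiples ∖ C) disjoint)) ⟩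
        card X + (card C + card (multiples ∖ C))      ≡⟨ cong (card X +_) (card-∪ C multiples) ⟨
        card X + card (C ∪ multiples)                 ≤⟨ le ⟩
        card X′ + card multiples                      ∎)
        where
        open ≤-Reasoning
        l : ∀ c kc z → suc (c + kc) + z ≡ suc kc + (c + z)
        l = solve-∀

    card≤2k*gain : ∀ k → 2 * card S ≤ q → 2 * card S ≤ suc (k * card C) → card S ≤ 2 * (k * μ)
    card≤2k*gain k 2S≤q 2S≤ = card≤2gain S (gain≤ S (k * μ)) (k * μ)
      (Sum.[ ≤-trans 2S≤q , ≤-trans 2S≤ ] (card-gain≤ k)) (λ le → le)

  -- Residue counts and occupied classes.

  count : List ℕ → ℕ → ℕ
  count = countRes q

  energy : List ℕ → ℕ
  energy L = ∑ q (λ k → count L k * count L k)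

  count-cong : ∀ L {x y} → x ≈ y → count L x ≡ count L y
  count-cong L = cong (λ r → length (filter (λ a → a % q ≟ r) L))

  count-∷ : ∀ a L k → count (a ∷ L) k ≡ ⟦ a % q ≟ k % q ⟧ + count L k
  count-∷ a L k with a % q ≡ᵇ k % q
  ... | true  = refl
  ... | false = refl

  -- The classes 1, ..., q and 0, ..., q - 1 are both full periods.
  sumSqCounts≡energy : ∀ L → sumSqCounts q L ≡ energy L
  sumSqCounts≡energy L = begin
    sum (map (square ∘ suc) (upTo q))  ≡⟨ cong sum (map-upTo (square ∘ suc) q) ⟩
    sum (applyUpTo (square ∘ suc) q)   ≡⟨ sum-applyUpTo (square ∘ suc) q ⟩
    ∑ q (square ∘ suc)                 ≡⟨ ∑-shift square (λ e → cong (λ n → n * n) (count-cong L e)) 1 ⟩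
    energy L                           ∎
    where
    open ≡-Reasoning
    square : ℕ → ℕ
    square k = count L k * count L k

  length≤∑count : ∀ L → length L ≤ ∑ q (count L)
  length≤∑count []      = z≤n
  length≤∑count (a ∷ L) = begin
    1 + length L                                   ≤⟨ +-mono-≤ 1≤ (length≤∑count L) ⟩
    ∑ q (λ k → ⟦ a % q ≟ k % q ⟧) + ∑ q (count L)  ≡⟨ ∑-+ q (λ k → ⟦ a % q ≟ k % q ⟧) (count L) ⟨
    ∑ q (λ k → ⟦ a % q ≟ k % q ⟧ + count L k)      ≡⟨ ∑-cong q (count-∷ a L) ⟨
    ∑ q (count (a ∷ L))                            ∎
    where
    open ≤-Reasoning
    1≤ : 1 ≤ ∑ q (λ k → ⟦ a % q ≟ k % q ⟧)
    1≤ = ≤-trans (≤-reflexive (sym (⟦⟧-yes (a % q ≟ a % q % q) (sym (m%n%n≡m%n a q)))))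
                 (term≤∑ (λ k → ⟦ a % q ≟ k % q ⟧) (m%n<n a q))

  energy-mono : ∀ {L M} → L ⊑ M → energy L ≤ energy M
  energy-mono {L} {M} L⊑M = ∑-mono q λ k → *-mono-≤ (mono k) (mono k)
    where
    mono : ∀ k → count L k ≤ count M k
    mono k = length-mono-≤ (filter⁺ (λ a → a % q ≟ k % q) (λ a → a % q ≟ k % q) (λ { refl e → e }) L⊑M)

  residues : List ℕ → ResidueSet
  residues L .Mem  k = 0 < count L k
  residues L .mem? k = 0 <? count L k
  residues L .resp e = subst (0 <_) (count-cong L e)

  ∈residues⇒ : ∀ L {c} → c ∈ residues L → ∃ λ a → a ∈ˡ L × a ≈ c
  ∈residues⇒ (a ∷ L) {c} c∈ = go (a % q ≟ c % q) (subst (0 <_) (count-∷ a L c) c∈)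
    where
    go : (a≈c? : Dec (a ≈ c)) → 0 < ⟦ a≈c? ⟧ + count L c → ∃ λ b → b ∈ˡ a ∷ L × b ≈ c
    go (yes a≈c) _  = a , here refl , a≈c
    go (no  _)   c∈ = let b , b∈L , b≈c = ∈residues⇒ L c∈ in b , there b∈L , b≈c

  length²≤card*energy : ∀ L → length L * length L ≤ card (residues L) * energy L
  length²≤card*energy L = ≤-trans (*-mono-≤ (length≤∑count L) (length≤∑count L))
    (∑-Cauchy-Schwarz q (count L) (𝟙 (residues L)) λ k → support (count L k))
    where
    support : ∀ n → n ≤ ⟦ 0 <? n ⟧ * n
    support zero    = z≤n
    support (suc n) = m≤m+n (suc n) 0

  -- Elements of large gain and the greedy construction.

  Proper : ResidueSet → Set
  Proper S = 0 < card S × 2 * card S ≤ q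

  Proper⇒∃∈∉ : ∀ S → Proper S → (∃ λ x → x ∈ S) × (∃ λ y → y ∉ S)
  Proper⇒∃∈∉ S (0<S , 2S≤q) =
    0<card⇒∃ S 0<S ,
    card<q⇒∃∉ S (<-≤-trans (m<m+n (card S) (≤-trans 0<S (m≤m+n (card S) 0))) 2S≤q)

  gain≥1 : ∀ S → Proper S → ∀ {a} → Generator a → 1 ≤ gain S a
  gain≥1 S proper gen with (x , x∈S) , (y , y∉S) ← Proper⇒∃∈∉ S proper =
    gain-positive S gen x∈S y∉S

  -- Let g = μ + 1 and suppose all gains are at most μ. For the k below, k |C| ≥ 8kg ≥ 2|S|, so
  -- `card≤2k*gain` gives |S| ≤ 2kμ < 2kg ≤ |S|.
  ∃-large-gain : ∀ S → Proper S → ∀ L → (∀ {a} → a ∈ˡ L → Generator a) →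
                 ∀ μ → 4 * suc μ ≤ card S → 8 * suc μ ≤ card (residues L) →
                 ∃ λ a → a ∈ˡ L × suc μ ≤ gain S a
  ∃-large-gain S proper@(_ , 2S≤q) L gens μ 4g≤S 8g≤C with any? (λ a → suc μ ≤? gain S a) L
  ... | yes large = find large
  ... | no ¬large with (x , x∈S) , (y , y∉S) ← Proper⇒∃∈∉ S proper =
    contradiction S≤2kμ (<⇒≱ (<-≤-trans (*-monoʳ-< 2 (*-monoʳ-< k (n<1+n μ))) 2kg≤S))
    where
    open ≤-Reasoning
    s k : ℕ
    s = card S
    -- Chosen so that s < 4gk ≤ 2s; the upper bound needs 4g ≤ s.
    k = suc (s / (4 * suc μ))

    s<k*4g : s < k * (4 * suc μ)
    s<k*4g = begin-strict
      s                                                ≡⟨ m≡m%n+[m/n]*n s (4 * suc μ) ⟩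
      s % (4 * suc μ) + s / (4 * suc μ) * (4 * suc μ)  <⟨ +-monoˡ-< _ (m%n<n s (4 * suc μ)) ⟩
      k * (4 * suc μ)                                  ∎

    2kg≤S : 2 * (k * suc μ) ≤ s
    2kg≤S = *-cancelˡ-≤ 2 (begin
      2 * (2 * (k * suc μ))                      ≡⟨ l k (suc μ) ⟩
      k * (4 * suc μ)                            ≡⟨⟩
      4 * suc μ + s / (4 * suc μ) * (4 * suc μ)  ≤⟨ +-mono-≤ 4g≤S (m/n*n≤m s (4 * suc μ)) ⟩
      s + s                                      ≡⟨ cong (s +_) (+-identityʳ s) ⟨
      2 * s                                      ∎)
      where
      l : ∀ k g → 2 * (2 * (k * g)) ≡ k * (4 * g)
      l = solve-∀

    2S≤k*C : 2 * s ≤ suc (k * card (residues L))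
    2S≤k*C = begin
      2 * s                        ≤⟨ *-monoʳ-≤ 2 (<⇒≤ s<k*4g) ⟩
      2 * (k * (4 * suc μ))        ≡⟨ l k (suc μ) ⟩
      k * (8 * suc μ)              ≤⟨ *-monoʳ-≤ k 8g≤C ⟩
      k * card (residues L)        ≤⟨ n≤1+n _ ⟩
      suc (k * card (residues L))  ∎
      where
      l : ∀ k g → 2 * (k * (4 * g)) ≡ k * (8 * g)
      l = solve-∀

    S≤2kμ : s ≤ 2 * (k * μ)
    S≤2kμ = card≤2k*gain S (residues L) x∈S y∉S
      (λ c∈ → let a , a∈L , a≈c = ∈residues⇒ L c∈ in Generator-resp a≈c (gens a∈L))
      μ
      (λ {c} c∈ → let a , a∈L , a≈c = ∈residues⇒ L c∈ in
        ≤-trans (gain-cong S {c} {a} (sym a≈c)) (s≤s⁻¹ (≰⇒> λ g≤ → ¬large (lose a∈L g≤))))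
      k 2S≤q 2S≤k*C

  -- Sums are traced backwards: enlarging S to S ∪ (S - a) spends a. For S = `multiples`, members of
  -- T are negatives of subset sums of L.
  MajorityReaches : List ℕ → ResidueSet → Set₁
  MajorityReaches L S = Σ ResidueSet λ T → q < 2 * card T ×
    (∀ {x} → x ∈ T → ∃ λ B → B ⊑ L × sum B + x ∈ S)

  majority-stop : ∀ L S → q < 2 * card S → MajorityReaches L S
  majority-stop L S q<2S = S , q<2S , λ x∈S → [] , minimum L , x∈S

  majority-step : ∀ {a L R} S → R ⊑ L →
    (∀ {B} → B ⊑ R → ∃ λ B′ → B′ ⊑ L × sum B′ ≡ a + sum B) →
    MajorityReaches R (S ∪ shift a S) → MajorityReaches L S
  majority-step {a} {L} {R} S R⊑L add (T , q<2T , reach) = T , q<2T , reach′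
    where
    reach′ : ∀ {x} → x ∈ T → ∃ λ B → B ⊑ L × sum B + x ∈ S
    reach′ {x} x∈T with reach x∈T
    ... | B , B⊑R , inj₁ ∈S = B , ⊆-trans B⊑R R⊑L , ∈S
    ... | B , B⊑R , inj₂ ∈S with B′ , B′⊑L , eq ← add B⊑R =
      B′ , B′⊑L , subst (_∈ S) (trans (sym (+-assoc a (sum B) x)) (cong (_+ x) (sym eq))) ∈S

  -- While at least ρ elements are unused and card S ≥ c, each step gains at least g.
  greedy : ∀ A g ρ c →
    (∀ R S → R ⊑ A → ρ ≤ length R → c ≤ card S → Proper S → ∃ λ a → a ∈ˡ R × g ≤ gain S a) →
    ∀ t L S → L ⊑ A → ρ + t ≤ length L → 0 < card S → c ≤ card S →
    (∀ R S′ → R ⊑ A → length L ≤ t + length R → card S + t * g ≤ card S′ → MajorityReaches R S′) →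
    MajorityReaches L S
  greedy A g ρ c large zero L S L⊑A _ _ _ continue =
    continue L S L⊑A ≤-refl (≤-reflexive (+-identityʳ (card S)))
  greedy A g ρ c large (suc t) L S L⊑A ρ+t≤L 0<S c≤S continue with 2 * card S ≤? q
  ... | no  2S≰q = majority-stop L S (≰⇒> 2S≰q)
  ... | yes 2S≤q
    with a , a∈L , g≤gain ← large L S L⊑A (≤-trans (m≤m+n ρ (suc t)) ρ+t≤L) c≤S (0<S , 2S≤q)
    with R , len , R⊑L , add ← remove-∈ a∈L =
    majority-step S R⊑L add
      (greedy A g ρ c large t R S⁺ (⊆-trans R⊑L L⊑A)
        (s≤s⁻¹ (≤-trans (≤-reflexive (sym (+-suc ρ t))) (≤-trans ρ+t≤L (≤-reflexive (sym len)))))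
        (≤-trans 0<S S≤S⁺) (≤-trans c≤S S≤S⁺)
        λ R′ S′ R′⊑A R≤ S⁺≤S′ → continue R′ S′ R′⊑A
          (≤-trans (≤-reflexive (sym len)) (s≤s R≤))
          (begin
            card S + suc t * g  ≡⟨ +-assoc (card S) g (t * g) ⟨
            card S + g + t * g  ≤⟨ +-monoˡ-≤ (t * g) S+g≤S⁺ ⟩
            card S⁺ + t * g     ≤⟨ S⁺≤S′ ⟩
            card S′             ∎))
    where
    open ≤-Reasoning
    S⁺ : ResidueSet
    S⁺ = S ∪ shift a S
    S+g≤S⁺ : card S + g ≤ card S⁺
    S+g≤S⁺ = ≤-trans (+-monoʳ-≤ (card S) g≤gain) (≤-reflexive (sym (card-∪-shift S a)))
    S≤S⁺ : card S ≤ card S⁺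
    S≤S⁺ = ≤-trans (m≤m+n (card S) g) S+g≤S⁺

  -- Numerical use of the two hypotheses on A.

  module _ (A : List ℕ) (gens : ∀ {a} → a ∈ˡ A → Generator a)
           (5184q<n² : 5184 * q < length A * length A)
           (energy-small : 7776 * q * energy A < length A * (length A * length A)) where

    private
      n : ℕ
      n = length A

      72<n : 72 < n
      72<n = ≰⇒> λ n≤72 → <⇒≱ 5184q<n²
        (≤-trans (*-mono-≤ n≤72 n≤72) (*-monoʳ-≤ 5184 (>-nonZero⁻¹ q)))

    instance
      n≢0 : NonZero n
      n≢0 = >-nonZero (≤-trans (s≤s z≤n) 72<n)

    unit-gain : ∀ R S → R ⊑ A → 1 ≤ length R → 0 ≤ card S → Proper S →
                ∃ λ a → a ∈ˡ R × 1 ≤ gain S a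
    unit-gain (a ∷ R) S R⊑A _ _ proper =
      a , here refl , gain≥1 S proper (gens (lookup R⊑A (here refl)))

    0<card-multiples : 0 < card multiples
    0<card-multiples = ∈⇒0<card multiples {0} refl

    -- Cauchy-Schwarz for R, with the energy of R bounded by that of A. The constants fit as 216 ·
    -- 6² = 7776.
    residues-many : ∀ R → R ⊑ A → n ≤ 6 * length R → 216 * q ≤ card (residues R) * n
    residues-many R R⊑A n≤6R = *-cancelʳ-≤ _ _ (n * n) {{m*n≢0 n n}} (begin
      216 * q * (n * n)                          ≤⟨ *-monoʳ-≤ (216 * q) (*-mono-≤ n≤6R n≤6R) ⟩
      216 * q * (6 * length R * (6 * length R))  ≡⟨ l₁ q (length R) ⟩
      7776 * q * (length R * length R)           ≤⟨ *-monoʳ-≤ (7776 * q) (length²≤card*energy R) ⟩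
      7776 * q * (D * energy R)                  ≤⟨ *-monoʳ-≤ (7776 * q) (*-monoʳ-≤ D (energy-mono R⊑A)) ⟩
      7776 * q * (D * energy A)                  ≡⟨ l₂ (7776 * q) D (energy A) ⟩
      D * (7776 * q * energy A)                  ≤⟨ *-monoʳ-≤ D (<⇒≤ energy-small) ⟩
      D * (n * (n * n))                          ≡⟨ *-assoc D n (n * n) ⟨
      D * n * (n * n)                            ∎)
      where
      open ≤-Reasoning
      D : ℕ
      D = card (residues R)
      l₁ : ∀ q r → 216 * q * (6 * r * (6 * r)) ≡ 7776 * q * (r * r)
      l₁ = solve-∀
      l₂ : ∀ a d e → a * (d * e) ≡ d * (a * e)
      l₂ = solve-∀

    half-reaches : ∀ L → L ⊑ A → n ≤ 2 + 2 * length L → MajorityReaches L multiples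
    half-reaches L L⊑A n≤2+2L with n ≤? 4 * q
    -- Here L has more than q elements, so q unit gains are affordable and suffice.
    ... | no n≰4q = greedy A 1 1 0 unit-gain q L multiples L⊑A 1+q≤L 0<card-multiples z≤n
      λ R S _ _ q<S → majority-stop R S (begin-strict
        q                       ≡⟨ *-identityʳ q ⟨
        q * 1                   <⟨ +-monoˡ-≤ (q * 1) 0<card-multiples ⟩
        card multiples + q * 1  ≤⟨ q<S ⟩
        card S                  ≤⟨ m≤m+n (card S) _ ⟩
        2 * card S              ∎)
      where
      open ≤-Reasoning
      l : ∀ q → 2 * q + 2 * q ≡ 4 * q
      l = solve-∀
      1+q≤L : 1 + q ≤ length L
      1+q≤L = *-cancelˡ-< 2 q (length L) (+-cancelˡ-< 2 _ _ (begin-strict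
        2 + 2 * q         ≤⟨ +-monoˡ-≤ (2 * q) (*-monoʳ-≤ 2 (>-nonZero⁻¹ q)) ⟩
        2 * q + 2 * q     ≡⟨ l q ⟩
        4 * q             <⟨ ≰⇒> n≰4q ⟩
        n                 ≤⟨ n≤2+2L ⟩
        2 + 2 * length L  ∎))
    ... | yes n≤4q =
      -- Two phases: 4g unit gains bring S to the size 4g that `∃-large-gain` demands, then t gains
      -- of g pass q/2.
      greedy A 1 1 0 unit-gain (4 * g) L multiples L⊑A
        (≤-trans (+-monoˡ-≤ (4 * g) {1} {ρ + t} (s≤s z≤n)) enough) 0<card-multiples z≤n
        λ R S R⊑A L≤ S+4g≤ →
          let 4g≤S = ≤-trans (≤-reflexive (sym (*-identityʳ (4 * g)))) (≤-trans (m≤n+m _ _) S+4g≤)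
          in
          greedy A g ρ (4 * g) large t R S R⊑A
            (+-cancelˡ-≤ (4 * g) _ _ (≤-trans (≤-reflexive (+-comm (4 * g) (ρ + t))) (≤-trans enough L≤)))
            (≤-trans (s≤s z≤n) 4g≤S) 4g≤S
            λ R′ S′ _ _ S+tg≤S′ → majority-stop R′ S′ (*-cancelˡ-< 4 _ _ (begin-strict
              4 * q              <⟨ 4q<ng ⟩
              n * g              ≤⟨ *-monoˡ-≤ g (<⇒≤ (n<[1+n/d]*d n 8)) ⟩
              t * 8 * g          ≡⟨ l₁ t g ⟩
              4 * (2 * (t * g))  ≤⟨ *-monoʳ-≤ 4 (*-monoʳ-≤ 2 (≤-trans (m≤n+m (t * g) (card S)) S+tg≤S′)) ⟩
              4 * (2 * card S′)  ∎))
      where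
      open ≤-Reasoning
      μ g t ρ : ℕ
      μ = 4 * q / n
      g = suc μ
      t = suc (n / 8)
      ρ = suc (n / 6)

      l₁ : ∀ t g → t * 8 * g ≡ 4 * (2 * (t * g))
      l₁ = solve-∀

      4q<ng : 4 * q < n * g
      4q<ng = <-≤-trans (n<[1+n/d]*d (4 * q) n) (≤-reflexive (*-comm g n))

      ng≤4q+n : n * g ≤ 4 * q + n
      ng≤4q+n = ≤-trans (≤-reflexive (*-comm n g)) ([1+n/d]*d≤n+d (4 * q) n)

      -- The bound |A| > 72√q enters here: 72² = 4 · 1296 yields 4q/n < n/1296.
      1296g≤n+1296 : 1296 * g ≤ n + 1296
      1296g≤n+1296 = *-cancelˡ-≤ n (begin
        n * (1296 * g)       ≡⟨ e₁ n g ⟩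
        1296 * (n * g)       ≤⟨ *-monoʳ-≤ 1296 ng≤4q+n ⟩
        1296 * (4 * q + n)   ≡⟨ e₂ q n ⟩
        5184 * q + n * 1296  ≤⟨ +-monoˡ-≤ (n * 1296) (<⇒≤ 5184q<n²) ⟩
        n * n + n * 1296     ≡⟨ *-distribˡ-+ n n 1296 ⟨
        n * (n + 1296)       ∎)
        where
        e₁ : ∀ n g → n * (1296 * g) ≡ 1296 * (n * g)
        e₁ = solve-∀
        e₂ : ∀ q n → 1296 * (4 * q + n) ≡ 5184 * q + n * 1296
        e₂ = solve-∀

      -- 648 = lcm(324, 8, 6) clears the denominators in ρ ≤ n/6 + 1, t ≤ n/8 + 1, 4g ≤ n/324 + 4.
      enough : ρ + t + 4 * g ≤ length L
      enough = *-cancelˡ-≤ 648 (+-cancelʳ-≤ 648 _ _ (begin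
        648 * (ρ + t + 4 * g) + 648                          ≡⟨ e₁ ρ t g ⟩
        108 * (ρ * 6) + 81 * (t * 8) + 2 * (1296 * g) + 648
          ≤⟨ +-monoˡ-≤ 648 (+-mono-≤ (+-mono-≤ (*-monoʳ-≤ 108 ([1+n/d]*d≤n+d n 6))
                                            (*-monoʳ-≤ 81 ([1+n/d]*d≤n+d n 8)))
                                 (*-monoʳ-≤ 2 1296g≤n+1296)) ⟩
        108 * (n + 6) + 81 * (n + 8) + 2 * (n + 1296) + 648  ≡⟨ e₂ n ⟩
        -- The constants total 4536 = 62 · 73 + 10, which n ≥ 73 absorbs.
        191 * n + 62 * 73 + 10
          ≤⟨ +-mono-≤ (+-monoʳ-≤ (191 * n) (*-monoʳ-≤ 62 72<n)) (≤-trans (m≤m+n 10 62) (<⇒≤ 72<n)) ⟩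
        191 * n + 62 * n + n                                 ≤⟨ m≤m+n _ (70 * n) ⟩
        191 * n + 62 * n + n + 70 * n                        ≡⟨ e₃ n ⟩
        324 * n                                              ≤⟨ *-monoʳ-≤ 324 n≤2+2L ⟩
        324 * (2 + 2 * length L)                             ≡⟨ e₄ (length L) ⟩
        648 * length L + 648                                 ∎))
        where
        e₁ : ∀ ρ t g → 648 * (ρ + t + 4 * g) + 648 ≡ 108 * (ρ * 6) + 81 * (t * 8) + 2 * (1296 * g) + 648
        e₁ = solve-∀
        e₂ : ∀ n → 108 * (n + 6) + 81 * (n + 8) + 2 * (n + 1296) + 648 ≡ 191 * n + 62 * 73 + 10
        e₂ = solve-∀
        e₃ : ∀ n → 191 * n + 62 * n + n + 70 * n ≡ 324 * n
        e₃ = solve-∀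
        e₄ : ∀ l → 324 * (2 + 2 * l) ≡ 648 * l + 648
        e₄ = solve-∀

      large : ∀ R S → R ⊑ A → ρ ≤ length R → 4 * g ≤ card S → Proper S →
              ∃ λ a → a ∈ˡ R × g ≤ gain S a
      large R S R⊑A ρ≤R 4g≤S proper =
        ∃-large-gain S proper R (gens ∘ lookup R⊑A) μ 4g≤S (*-cancelʳ-≤ _ _ n (begin
          8 * g * n              ≡⟨ e₁ g n ⟩
          -- The case n ≤ 4q absorbs the rounding error n in ng ≤ 4q + n.
          8 * (n * g)            ≤⟨ *-monoʳ-≤ 8 (≤-trans ng≤4q+n (+-monoʳ-≤ (4 * q) n≤4q)) ⟩
          8 * (4 * q + 4 * q)    ≡⟨ e₂ q ⟩
          64 * q                 ≤⟨ *-monoˡ-≤ q (m≤m+n 64 152) ⟩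
          216 * q                ≤⟨ residues-many R R⊑A n≤6R ⟩
          card (residues R) * n  ∎))
        where
        e₁ : ∀ g n → 8 * g * n ≡ 8 * (n * g)
        e₁ = solve-∀
        e₂ : ∀ q → 8 * (4 * q + 4 * q) ≡ 64 * q
        e₂ = solve-∀
        n≤6R : n ≤ 6 * length R
        n≤6R = begin
          n             ≤⟨ <⇒≤ (n<[1+n/d]*d n 6) ⟩
          ρ * 6         ≡⟨ *-comm ρ 6 ⟩
          6 * ρ         ≤⟨ *-monoʳ-≤ 6 ρ≤R ⟩
          6 * length R  ∎

  -- Combining the two halves.

  -- Passing to the complement of a sub-collection of L₂ turns the condition
  -- ΣB₂ ≈ − x₂ into a prescribed value + x₂, so a single translate of T₁ has to meet T₂.
  majorities-cover : ∀ a L₁ L₂ → MajorityReaches L₁ multiples → MajorityReaches L₂ multiples →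
                     ∀ r → ∃ λ B → B ⊑ L₁ ++ L₂ × sum (a ∷ B) ≈ r
  majorities-cover a L₁ L₂ (T₁ , q<2T₁ , reach₁) (T₂ , q<2T₂ , reach₂) r =
    let x  , c+x∈T₁ , x∈T₂      = 0<card⇒∃ (shift c T₁ ∩ T₂) 0<∩
        B₁  , B₁⊑L₁ , B₁≈        = reach₁ c+x∈T₁
        B₂  , B₂⊑L₂ , B₂≈        = reach₂ x∈T₂
        B₂′ , B₂′⊑L₂ , eq        = complement B₂⊑L₂
    in
    B₁ ++ B₂′ , ++⁺ B₁⊑L₁ B₂′⊑L₂ , (begin
      (a + sum (B₁ ++ B₂′)) % q                      ≡⟨ cong (λ s → (a + s) % q) (sum-++ B₁ B₂′) ⟩
      (a + (sum B₁ + sum B₂′)) % q                   ≡⟨ cong (_% q) (+-identityʳ _) ⟨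
      (a + (sum B₁ + sum B₂′) + 0) % q               ≡⟨ +-cong-≈ {a + (sum B₁ + sum B₂′)} refl (sym B₂≈) ⟩
      (a + (sum B₁ + sum B₂′) + (sum B₂ + x)) % q    ≡⟨ cong (_% q) (e₁ a (sum B₁) (sum B₂′) (sum B₂) x) ⟩
      (a + sum B₁ + (sum B₂′ + sum B₂) + x) % q      ≡⟨ cong (λ s → (a + sum B₁ + s + x) % q) eq ⟩
      (a + sum B₁ + sum L₂ + x) % q                  ≡⟨ neg-cancel r (a + sum B₁ + sum L₂ + x) ⟨
      (neg r + (r + (a + sum B₁ + sum L₂ + x))) % q  ≡⟨ cong (_% q) (e₂ a (sum B₁) (sum L₂) x (neg r) r) ⟩
      (r + (sum B₁ + (c + x))) % q                   ≡⟨ +-cong-≈ {r} refl B₁≈ ⟩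
      (r + 0) % q                                    ≡⟨ cong (_% q) (+-identityʳ r) ⟩
      r % q                                          ∎)
    where
    open ≡-Reasoning
    c : ℕ
    -- Then ΣB₁ + c + x ≈ 0 says a + ΣB₁ + (ΣL₂ + x) ≈ r, and ΣL₂ + x is the sum of the complement
    -- of B₂.
    c = a + sum L₂ + neg r
    e₁ : ∀ a s t u x → a + (s + t) + (u + x) ≡ a + s + (t + u) + x
    e₁ = solve-∀
    e₂ : ∀ a s l x m r → m + (r + (a + s + l + x)) ≡ r + (s + (a + l + m + x))
    e₂ = solve-∀
    0<∩ : 0 < card (shift c T₁ ∩ T₂)
    0<∩ = +-cancelˡ-< q _ _ (*-cancelˡ-< 2 _ _ (R.begin-strict
      2 * (q + 0)                                            R.≡⟨ e₃ q ⟩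
      q + q                                                  R.<⟨ +-mono-< q<2T₁ q<2T₂ ⟩
      2 * card T₁ + 2 * card T₂                              R.≡⟨ *-distribˡ-+ 2 (card T₁) (card T₂) ⟨
      2 * (card T₁ + card T₂)
        R.≡⟨ cong (λ k → 2 * (k + card T₂)) (card-shift c T₁) ⟨
      2 * (card (shift c T₁) + card T₂)
        R.≡⟨ cong (2 *_) (card-∪+card-∩ (shift c T₁) T₂) ⟨
      2 * (card (shift c T₁ ∪ T₂) + card (shift c T₁ ∩ T₂))
        R.≤⟨ *-monoʳ-≤ 2 (+-monoˡ-≤ _ (card≤q (shift c T₁ ∪ T₂))) ⟩
      2 * (q + card (shift c T₁ ∩ T₂))                       R.∎))
      where
      module R = ≤-Reasoning
      e₃ : ∀ q → 2 * (q + 0) ≡ q + q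
      e₃ = solve-∀

theorem5p5 : (q : ℕ) .{{_ : NonZero q}} (A : List ℕ) →
    Unique A →
    All (λ a → 0 < a) A →
    All (λ a → gcd a q ≡ 1) A →
    5184 * q < length A ^ 2 →
    7776 * q * sumSqCounts q A < length A ^ 3 →
    (r : ℕ) → r < q → Σ ℕ (λ s → InSubsetSums A s × (s % q ≡ r))
theorem5p5 q [] _ _ _ ()
theorem5p5 q A@(a ∷ A′) _ _ coprime 5184q<n² energy-small r r<q =
  -- The head a is always used, which makes the sub-collection nonempty; the tail is split into two
  -- halves.
  let B , B⊑ , sum≈r = majorities-cover a (take h A′) (drop h A′)
        (reaches (take h A′) (a ∷ʳ take-⊆ h A′) (n≤ (take h A′) h≤take))
        (reaches (drop h A′) (a ∷ʳ drop-⊆ h A′) (n≤ (drop h A′) h≤drop)) r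
  in sum (a ∷ B)
   , (a ∷ B , refl ∷ subst (B ⊑_) (take++drop≡id h A′) B⊑ , (λ ()) , refl)
   , trans sum≈r (m<n⇒m%n≡m r<q)
  where
  open Cyclic q
  open ≤-Reasoning
  n² : length A ^ 2 ≡ length A * length A
  n² = cong (length A *_) (*-identityʳ (length A))

  reaches : ∀ L → L ⊑ A → length A ≤ 2 + 2 * length L → MajorityReaches L multiples
  reaches = half-reaches A (λ a∈A → coprime⇒Generator (All.lookup coprime a∈A))
    (subst (5184 * q <_) n² 5184q<n²)
    (subst₂ _<_ (cong (7776 * q *_) (sumSqCounts≡energy A)) (cong (length A *_) n²) energy-small)

  h : ℕ
  h = length A′ / 2

  2h≤A′ : h * 2 ≤ length A′
  2h≤A′ = m/n*n≤m (length A′) 2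

  h≤A′ : h ≤ length A′
  h≤A′ = m/n≤m (length A′) 2

  h≤take : h ≤ length (take h A′)
  h≤take = ≤-reflexive (sym (trans (length-take h A′) (m≤n⇒m⊓n≡m h≤A′)))

  h≤drop : h ≤ length (drop h A′)
  h≤drop = begin
    h                       ≡⟨ m+n∸n≡m h h ⟨
    h + h ∸ h               ≤⟨ ∸-monoˡ-≤ h h+h≤A′ ⟩
    length A′ ∸ h           ≡⟨ length-drop h A′ ⟨
    length (drop h A′)      ∎
    where
    e : ∀ h → h + h ≡ h * 2
    e = solve-∀
    h+h≤A′ : h + h ≤ length A′
    h+h≤A′ = ≤-trans (≤-reflexive (e h)) 2h≤A′

  n≤ : ∀ L → h ≤ length L → length A ≤ 2 + 2 * length L
  n≤ L h≤L = begin
    -- The 2 pays for the head and for an odd tail.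
    suc (length A′)   ≤⟨ n<[1+n/d]*d (length A′) 2 ⟩
    2 + h * 2         ≡⟨ cong (2 +_) (*-comm h 2) ⟩
    2 + 2 * h         ≤⟨ +-monoʳ-≤ 2 (*-monoʳ-≤ 2 h≤L) ⟩
    2 + 2 * length L  ∎
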